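{- Let $a\in\mathbb{N}$ and let $M$ be a strongly chromatic-choosable graph with $\chi(M) \geq a + 1$. Then $$f_a(M) = \bigl(P_\ell(M, \chi_\ell(M) + a - 1)\bigr)^a.$$
   Context: All graphs are finite, simple and nonempty; $\mathbb{N}=\{1,2,\dots\}$. A list assignment $L$ for a graph assigns to each vertex $v$ a set $L(v)$ of colors; a proper $L$-coloring is a proper coloring $c$ with $c(v)\in L(v)$ for all $v$; $G$ is $L$-colorable if one exists. $L$ is a $k$-assignment if $|L(v)|=k$ for all $v$, and is constant if all lists are equal. $\chi_\ell(G)$ is the least $k$ such that $G$ is $L$-colorable for every $k$-assignment $L$. The list color function $P_\ell(G,k)$ is the minimum, over all $k$-assignments $L$ for $G$, of the number of proper $L$-colorings of $G$. A graph $G$ is strong $k$-chromatic-choosable if $\chi(G)=k$ and every $(k-1)$-assignment $L$ for which $G$ is not $L$-colorable is constant; $G$ is strongly chromatic-choosable if it is strong $\chi(G)$-chromatic-choosable. The Cartesian product $G \square H$ has vertex set $V(G)\times V(H)$, with $(u,v)$ adjacent to $(u',v')$ iff either $u=u'$ and $vv'\in E(H)$, or $v=v'$ and $uu'\in E(G)$. $K_{a,b}$ is the complete bipartite graph with parts of sizes $a$ and $b$. $f_a(G)$ denotes the smallest $b\in\mathbb{N}$ such that $\chi_\ell(G \square K_{a,b}) = \chi_\ell(G) + a$. -}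

module Defs where

open import Data.Nat using (ℕ; zero; suc; _+_; _*_; _∸_; _≤_; _<ᵇ_)
open import Data.Bool using (Bool; true; false; not; _∧_; _∨_; _xor_)
open import Data.Fin using (Fin; toℕ; remQuot; _≟_)
open import Data.Fin.Properties using ()
open import Data.List using (List; []; _∷_; length; filter; map; concatMap; foldr; allFin)
open import Data.List.Membership.Propositional using (_∈_)
open import Data.List.Relation.Unary.Unique.Propositional using (Unique)
open import Data.Vec using (Vec; lookup) renaming ([] to []ᵥ; _∷_ to _∷ᵥ_)
open import Data.Product using (Σ; _×_; _,_; proj₁; proj₂)
open import Relation.Binary.PropositionalEquality using (_≡_; _≢_; refl; sym)
open import Relation.Nullary using (¬_; yes; no; does)
open import Data.Nat using (_≡ᵇ_)

record Graph : Set where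
  field
    n      : ℕ
    adj    : Fin n → Fin n → Bool
    adj-sym : ∀ u v → adj u v ≡ adj v u
    adj-irrefl : ∀ u → adj u u ≡ false
open Graph public

eqF : ∀ {k} → Fin k → Fin k → Bool
eqF i j = does (i ≟ j)

eqF-sym : ∀ {k} (i j : Fin k) → eqF i j ≡ eqF j i
eqF-sym i j with i ≟ j | j ≟ i
... | yes _ | yes _ = refl
... | no _  | no _  = refl
... | yes p | no q  with q (sym p)
... | ()
eqF-sym i j | no q | yes p with q (sym p)
... | ()

eqF-refl : ∀ {k} (i : Fin k) → eqF i i ≡ true
eqF-refl i with i ≟ i
... | yes _ = refl
... | no q with q refl
... | ()

□-adjPair : (G H : Graph) → Fin (n G) × Fin (n H) → Fin (n G) × Fin (n H) → Bool
□-adjPair G H (u , v) (u' , v') = (eqF u u' ∧ adj H v v') ∨ (eqF v v' ∧ adj G u u')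

□-adj : (G H : Graph) → Fin (n G * n H) → Fin (n G * n H) → Bool
□-adj G H i j = □-adjPair G H (remQuot (n H) i) (remQuot (n H) j)

□-pairSym : (G H : Graph) → ∀ x y → □-adjPair G H x y ≡ □-adjPair G H y x
□-pairSym G H (u , v) (u' , v')
  rewrite eqF-sym u u' | eqF-sym v v' | adj-sym H v v' | adj-sym G u u' = refl

□-pairIrrefl : (G H : Graph) → ∀ x → □-adjPair G H x x ≡ false
□-pairIrrefl G H (u , v)
  rewrite eqF-refl u | eqF-refl v | adj-irrefl H v | adj-irrefl G u = refl

□-sym : (G H : Graph) → ∀ i j → □-adj G H i j ≡ □-adj G H j i
□-sym G H i j = □-pairSym G H (remQuot (n H) i) (remQuot (n H) j)

□-irrefl : (G H : Graph) → ∀ i → □-adj G H i i ≡ false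
□-irrefl G H i = □-pairIrrefl G H (remQuot (n H) i)

_□_ : Graph → Graph → Graph
G □ H = record { n = n G * n H ; adj = □-adj G H ; adj-sym = □-sym G H ; adj-irrefl = □-irrefl G H }

xor-comm' : ∀ x y → x xor y ≡ y xor x
xor-comm' false false = refl
xor-comm' false true  = refl
xor-comm' true  false = refl
xor-comm' true  true  = refl

xor-self : ∀ x → x xor x ≡ false
xor-self false = refl
xor-self true  = refl

K : ℕ → ℕ → Graph
K a b = record
  { n = a + b
  ; adj = λ i j → (toℕ i <ᵇ a) xor (toℕ j <ᵇ a)
  ; adj-sym = λ i j → xor-comm' (toℕ i <ᵇ a) (toℕ j <ᵇ a)
  ; adj-irrefl = λ i → xor-self (toℕ i <ᵇ a)
  }

Proper : (G : Graph) → (Fin (n G) → ℕ) → Set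
Proper G c = ∀ u v → adj G u v ≡ true → c u ≢ c v

Colorable : Graph → ℕ → Set
Colorable G k = Σ (Fin (n G) → Fin k) λ c → Proper G (λ v → toℕ (c v))

IsChromaticNumber : Graph → ℕ → Set
IsChromaticNumber G k = Colorable G k × (∀ j → Colorable G j → k ≤ j)

-- List assignments: each list is a duplicate-free list of colors (a finite set)
ListAssignment : Graph → Set
ListAssignment G = Fin (n G) → List ℕ

IsAssignment : (G : Graph) → ℕ → ListAssignment G → Set
IsAssignment G k L = ∀ v → Unique (L v) × length (L v) ≡ k

LColorable : (G : Graph) → ListAssignment G → Set
LColorable G L = Σ (Fin (n G) → ℕ) λ c → (∀ v → c v ∈ L v) × Proper G c

Constant : (G : Graph) → ListAssignment G → Set
Constant G L = ∀ u v x → (x ∈ L u → x ∈ L v) × (x ∈ L v → x ∈ L u)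

Choosable : Graph → ℕ → Set
Choosable G k = ∀ L → IsAssignment G k L → LColorable G L

IsChoiceNumber : Graph → ℕ → Set
IsChoiceNumber G k = Choosable G k × (∀ j → Choosable G j → k ≤ j)

choices : ∀ m → (Fin m → List ℕ) → List (Vec ℕ m)
choices zero    L = []ᵥ ∷ []
choices (suc m) L =
  concatMap (λ x → map (x ∷ᵥ_) (choices m (λ i → L (Fin.suc i)))) (L Fin.zero)
  where import Data.Fin as Fin

allᵇ : ∀ {A : Set} → (A → Bool) → List A → Bool
allᵇ p = foldr (λ x b → p x ∧ b) true

isProperᵇ : (G : Graph) → Vec ℕ (n G) → Bool
isProperᵇ G c =
  allᵇ (λ u → allᵇ (λ v → not (adj G u v ∧ (lookup c u ≡ᵇ lookup c v))) (allFin (n G))) (allFin (n G))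

numColorings : (G : Graph) → ListAssignment G → ℕ
numColorings G L = length (filter (λ c → isProperᵇ G c Data.Bool.≟ true) (choices (n G) L))
  where import Data.Bool

IsListColorFunction : Graph → ℕ → ℕ → Set
IsListColorFunction G k p =
  (Σ (ListAssignment G) λ L → IsAssignment G k L × numColorings G L ≡ p)
  × (∀ L → IsAssignment G k L → p ≤ numColorings G L)

StrongChromaticChoosable : Graph → ℕ → Set
StrongChromaticChoosable G k =
  IsChromaticNumber G k
  × (∀ L → IsAssignment G (k ∸ 1) L → ¬ LColorable G L → Constant G L)

StronglyChromaticChoosable : Graph → Set
StronglyChromaticChoosable G = Σ ℕ λ k → StrongChromaticChoosable G k

FaProp : ℕ → Graph → ℕ → Set
FaProp a G b = Σ ℕ λ l → IsChoiceNumber G l × IsChoiceNumber (G □ K a b) (l + a)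

IsFa : ℕ → Graph → ℕ → Set
IsFa a G b = 1 ≤ b × FaProp a G b × (∀ b' → 1 ≤ b' → FaProp a G b' → b ≤ b')

{-# OPTIONS --safe #-}
module Submission where

-- Write k = χ(M). If all lists of M have at least k − 1 colors, and one of them has more, then M is
-- colorable: otherwise strength would make differently chosen (k − 1)-subsets equal. So
-- χ_ℓ(M) = k, any one vertex can be given any of its colors when lists have size k, and
-- χ_ℓ(M □ K_{a,b}) ≤ k + a because a vertex on the b-side loses at most a colors.
--
-- Given lists of size k + a − 1, call a joint coloring of the a copies of M bad for a copy on the
-- b-side if it does not extend to it. Then the leftover lists on that copy all equal one
-- (k − 1)-set. If two of the a copies share a color at a vertex, using it on both avoids badness
-- everywhere. If not, a second bad coloring for the same copy would give a color x used at every
-- vertex by some member of the first one, hence a proper a-coloring of M, although χ(M) > a. So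
-- each of the b copies spoils at most one of the at least p^a joint colorings, where
-- p = P_ℓ(M, k + a − 1). Conversely, disjoint
-- copies of an assignment with exactly p colorings let p^a copies spoil all of them.

open import Defs
open import Data.Nat using (ℕ; zero; suc; _+_; _*_; _∸_; _^_; _≤_; _<_; _<ᵇ_; _≡ᵇ_; z≤n; s≤s; s≤s⁻¹; >-nonZero; _≤?_)
open import Data.Nat.Properties as ℕₚ using (≤-reflexive; ≤-trans; ≤-antisym; <⇒≱; ≰⇒>)
open import Data.Nat.DivMod using (_%_; [m+kn]%n≡m%n; m≤n⇒m%n≡m)
open import Data.Bool using (Bool; true; false; not; _∧_; _xor_; T) renaming (_≟_ to _≟ᵇ_)
import Data.Bool.Properties as Boolₚ
open import Data.Fin using (Fin; zero; suc; toℕ; fromℕ<; inject≤; remQuot; combine; splitAt; join; punchIn; punchOut; funToFin; finToFun) renaming (_≟_ to _≟ᶠ_)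
open import Data.Fin.Properties as Finₚ using (any?; all?)
open import Data.List using (List; []; _∷_; _++_; [_]; length; filter; map; concatMap; cartesianProductWith; take; upTo; tabulate; allFin) renaming (lookup to lookupₗ)
open import Data.List.Properties using (length-++; length-map; length-tabulate; length-upTo; length-take)
open import Data.List.Membership.Propositional using (_∈_; _∉_; find; lose)
open import Data.List.Membership.Propositional.Properties
open import Data.List.Membership.DecPropositional ℕₚ._≟_ using (_∈?_; _∉?_)
open import Data.List.Relation.Binary.Subset.Propositional using (_⊆_)
import Data.List.Relation.Unary.All as All
import Data.List.Relation.Unary.Any as Any
open import Data.List.Relation.Unary.Any using (here; there)
import Data.List.Relation.Unary.Any.Properties as Anyₚ
open import Data.List.Relation.Unary.AllPairs using ([]; _∷_)
open import Data.List.Relation.Unary.Unique.Propositional using (Unique)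
import Data.List.Relation.Unary.Unique.Propositional.Properties as Uniqueₚ
open import Data.Product using (∃; _×_; _,_; proj₁; proj₂)
open import Data.Sum using (_⊎_; inj₁; inj₂)
open import Data.Vec using (Vec) renaming ([] to []ᵥ; _∷_ to _∷ᵥ_; lookup to lookupᵥ; tabulate to tabulateᵥ)
import Data.Vec.Properties as Vecₚ
import Data.Vec.Functional as F
import Data.Vec.Functional.Properties as Fₚ
open import Function using (_∘_; const; case_of_; module Equivalence)
open import Relation.Binary.PropositionalEquality using (_≡_; _≢_; _≗_; refl; sym; trans; cong; cong₂; subst; subst₂; module ≡-Reasoning)
open import Relation.Nullary using (¬_; Dec; yes; no; contradiction; ¬?; _×-dec_)

-- Finite sets as duplicate-free lists

lookup-injective : ∀ {A : Set} {xs : List A} → Unique xs →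
  ∀ i j → lookupₗ xs i ≡ lookupₗ xs j → i ≡ j
lookup-injective (_ ∷ _)  zero    zero    _  = refl
lookup-injective (x∉ ∷ _) zero    (suc j) eq = contradiction eq (All.lookup x∉ (∈-lookup j))
lookup-injective (x∉ ∷ _) (suc i) zero    eq = contradiction (sym eq) (All.lookup x∉ (∈-lookup i))
lookup-injective (_ ∷ u)  (suc i) (suc j) eq = cong suc (lookup-injective u i j eq)

length-mono-⊆ : ∀ {A : Set} {xs ys : List A} → Unique xs → xs ⊆ ys → length xs ≤ length ys
length-mono-⊆ {xs = xs} {ys} u xs⊆ys = Finₚ.injective⇒≤ {f = position} λ {i} {j} eq →
  lookup-injective u i j (begin
    lookupₗ xs i            ≡⟨ Anyₚ.lookup-index (xs⊆ys (∈-lookup i)) ⟩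
    lookupₗ ys (position i) ≡⟨ cong (lookupₗ ys) eq ⟩
    lookupₗ ys (position j) ≡⟨ Anyₚ.lookup-index (xs⊆ys (∈-lookup j)) ⟨
    lookupₗ xs j            ∎)
  where
  open ≡-Reasoning
  position : Fin (length xs) → Fin (length ys)
  position i = Any.index (xs⊆ys (∈-lookup i))

take-⊆ : ∀ {A : Set} k {xs : List A} → take k xs ⊆ xs
take-⊆ (suc k) {_ ∷ _} (here eq)  = here eq
take-⊆ (suc k) {_ ∷ _} (there x∈) = there (take-⊆ k x∈)

length-take-≤ : ∀ {A : Set} k {xs : List A} → k ≤ length xs → length (take k xs) ≡ k
length-take-≤ k {xs} k≤ = trans (length-take k xs) (ℕₚ.m≤n⇒m⊓n≡m k≤)

infixl 6 _∖_
_∖_ : List ℕ → List ℕ → List ℕ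
xs ∖ ys = filter (_∉? ys) xs

∖⁺ : ∀ {x xs ys} → x ∈ xs → x ∉ ys → x ∈ xs ∖ ys
∖⁺ {ys = ys} = ∈-filter⁺ (_∉? ys)

∖⁻ : ∀ {x} xs ys → x ∈ xs ∖ ys → x ∈ xs × x ∉ ys
∖⁻ xs ys = ∈-filter⁻ (_∉? ys) {xs = xs}

∖-unique : ∀ {xs} ys → Unique xs → Unique (xs ∖ ys)
∖-unique ys = Uniqueₚ.filter⁺ (_∉? ys)

-- Only colors of `xs` that lie in `ys` are charged to `zs`, so repetitions in `ys` and colors
-- outside `xs` cost nothing; `avoid-redundant` depends on this.
length-∖ : ∀ {xs} ys zs → Unique xs → (∀ {x} → x ∈ xs → x ∈ ys → x ∈ zs) →
  length xs ≤ length (xs ∖ ys) + length zs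
length-∖ {xs} ys zs u covered =
  subst (length xs ≤_) (length-++ (xs ∖ ys)) (length-mono-⊆ u split)
  where
  split : xs ⊆ (xs ∖ ys) ++ zs
  split {x} x∈ with x ∈? ys
  ... | yes x∈ys = ∈-++⁺ʳ (xs ∖ ys) (covered x∈ x∈ys)
  ... | no  x∉ys = ∈-++⁺ˡ (∖⁺ x∈ x∉ys)

-- Brings `x` into the prefix that `take` keeps.
moveToFront : ℕ → List ℕ → List ℕ
moveToFront x xs = x ∷ xs ∖ [ x ]

moveToFront-⊆ : ∀ {x xs} → x ∈ xs → moveToFront x xs ⊆ xs
moveToFront-⊆ x∈ (here refl) = x∈
moveToFront-⊆ {x} {xs} x∈ (there y∈) = proj₁ (∖⁻ xs [ x ] y∈)

moveToFront-unique : ∀ x {xs} → Unique xs → Unique (moveToFront x xs)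
moveToFront-unique x {xs} u =
  All.tabulate (λ y∈ x≡y → proj₂ (∖⁻ xs [ x ] y∈) (here (sym x≡y))) ∷ ∖-unique [ x ] u

length-moveToFront : ∀ x {xs} → Unique xs → length xs ≤ length (moveToFront x xs)
length-moveToFront x {xs} u =
  subst (length xs ≤_) (ℕₚ.+-comm (length (xs ∖ [ x ])) 1) (length-∖ [ x ] [ x ] u λ _ x∈ → x∈)

updateAt-all : ∀ {A : Set} {m} {f : A → A} (P : Fin m → A → Set) (xs : Fin m → A) i →
  P i (f (xs i)) → (∀ j → j ≢ i → P j (xs j)) → ∀ j → P j (F.updateAt xs i f j)
updateAt-all P xs i pᵢ p j with j ≟ᶠ i
... | yes refl = subst (P i) (sym (Fₚ.updateAt-updates i xs)) pᵢ
... | no j≢i   = subst (P j) (sym (Fₚ.updateAt-minimal j i xs j≢i)) (p j j≢i)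

finToFun-injective : ∀ {m k} (s t : Fin (m ^ k)) → finToFun {m} {k} s ≗ finToFun t → s ≡ t
finToFun-injective {m} {k} s t eq =
  trans (sym (Finₚ.funToFin-finToFin {k} s)) (trans (funToFin-cong eq) (Finₚ.funToFin-finToFin {k} t))
  where
  funToFin-cong : ∀ {k} {f g : Fin k → Fin m} → f ≗ g → funToFin f ≡ funToFin g
  funToFin-cong {zero}  _  = refl
  funToFin-cong {suc k} eq = cong₂ combine (eq zero) (funToFin-cong (eq ∘ suc))

-- Enumerating the proper L-colorings

IsColoring : (G : Graph) → ListAssignment G → (Fin (n G) → ℕ) → Set
IsColoring G L c = (∀ v → c v ∈ L v) × Proper G c

IsColoring-resp : ∀ G {L c d} → c ≗ d → IsColoring G L c → IsColoring G L d
IsColoring-resp G {L} eq (c∈ , proper) =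
  (λ v → subst (_∈ L v) (eq v) (c∈ v)) ,
  (λ u v uv d≡ → proper u v uv (trans (eq u) (trans d≡ (sym (eq v)))))

-- In the form of a cartesian product, membership and uniqueness follow coordinate by coordinate.
choices-suc : ∀ {m} (L : Fin (suc m) → List ℕ) →
  choices (suc m) L ≡ cartesianProductWith _∷ᵥ_ (L zero) (choices m (L ∘ suc))
choices-suc {m} L = go (L zero)
  where
  vs = choices m (L ∘ suc)
  go : ∀ xs → concatMap (λ x → map (x ∷ᵥ_) vs) xs ≡ cartesianProductWith _∷ᵥ_ xs vs
  go []       = refl
  go (x ∷ xs) = cong (map (x ∷ᵥ_) vs ++_) (go xs)

choices⁺ : ∀ {m} {L : Fin m → List ℕ} (c : Vec ℕ m) → (∀ i → lookupᵥ c i ∈ L i) → c ∈ choices m L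
choices⁺ []ᵥ _ = here refl
choices⁺ {L = L} (x ∷ᵥ c) c∈ =
  subst ((x ∷ᵥ c) ∈_) (sym (choices-suc L)) (∈-cartesianProductWith⁺ _∷ᵥ_ (c∈ zero) (choices⁺ c (c∈ ∘ suc)))

choices⁻ : ∀ {m} {L : Fin m → List ℕ} {c} → c ∈ choices m L → ∀ i → lookupᵥ c i ∈ L i
choices⁻ {suc m} {L} {c} c∈ i
  with ∈-cartesianProductWith⁻ _∷ᵥ_ (L zero) (choices m (L ∘ suc)) (subst (c ∈_) (choices-suc L) c∈)
choices⁻ c∈ zero    | _ , _ , x∈ , _ , refl = x∈
choices⁻ c∈ (suc i) | _ , _ , _ , v∈ , refl = choices⁻ v∈ i

choices-unique : ∀ {m} {L : Fin m → List ℕ} → (∀ i → Unique (L i)) → Unique (choices m L)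
choices-unique {zero}      _ = All.[] ∷ []
choices-unique {suc m} {L} u = subst Unique (sym (choices-suc L))
  (Uniqueₚ.cartesianProductWith⁺ _∷ᵥ_ Vecₚ.∷-injective (u zero) (choices-unique (u ∘ suc)))

allᵇ⁺ : ∀ {A : Set} (q : A → Bool) xs → (∀ x → q x ≡ true) → allᵇ q xs ≡ true
allᵇ⁺ q []       _ = refl
allᵇ⁺ q (x ∷ xs) h rewrite h x = allᵇ⁺ q xs h

allᵇ⁻ : ∀ {A : Set} (q : A → Bool) {xs} → allᵇ q xs ≡ true → ∀ {x} → x ∈ xs → q x ≡ true
allᵇ⁻ q {y ∷ _} h x∈ with q y in eq
allᵇ⁻ q h (here refl) | true = eq
allᵇ⁻ q h (there x∈)  | true = allᵇ⁻ q h x∈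

module _ (G : Graph) where

  distinctᵇ : Vec ℕ (n G) → Fin (n G) → Fin (n G) → Bool
  distinctᵇ c u v = not (adj G u v ∧ (lookupᵥ c u ≡ᵇ lookupᵥ c v))

  isProperᵇ⁺ : ∀ c → Proper G (lookupᵥ c) → isProperᵇ G c ≡ true
  isProperᵇ⁺ c proper = allᵇ⁺ _ (allFin (n G)) λ u → allᵇ⁺ (distinctᵇ c u) (allFin (n G)) (distinct u)
    where
    distinct : ∀ u v → distinctᵇ c u v ≡ true
    distinct u v with adj G u v in uv | lookupᵥ c u ≡ᵇ lookupᵥ c v in eq
    ... | false | _     = refl
    ... | true  | false = refl
    ... | true  | true  =
      contradiction (ℕₚ.≡ᵇ⇒≡ _ _ (subst T (sym eq) _)) (proper u v uv)

  isProperᵇ⁻ : ∀ c → isProperᵇ G c ≡ true → Proper G (lookupᵥ c)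
  isProperᵇ⁻ c h u v uv eq
    with allᵇ⁻ (distinctᵇ c u) (allᵇ⁻ (λ u → allᵇ (distinctᵇ c u) (allFin (n G))) h (∈-allFin u)) (∈-allFin v)
  ... | d rewrite uv | eq | Boolₚ.T-≡ .Equivalence.to (ℕₚ.≡⇒≡ᵇ (lookupᵥ c v) (lookupᵥ c v) refl) =
    case d of λ ()

  -- Its length is `numColorings G L` by definition, so `Fin (numColorings G L)` indexes the proper
  -- colorings.
  colorings : ListAssignment G → List (Vec ℕ (n G))
  colorings L = filter (λ c → isProperᵇ G c ≟ᵇ true) (choices (n G) L)

  colorings⁺ : ∀ {L} c → IsColoring G L (lookupᵥ c) → c ∈ colorings L
  colorings⁺ c (c∈ , proper) =
    ∈-filter⁺ (λ c → isProperᵇ G c ≟ᵇ true) (choices⁺ c c∈) (isProperᵇ⁺ c proper)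

  colorings⁻ : ∀ {L c} → c ∈ colorings L → IsColoring G L (lookupᵥ c)
  colorings⁻ {L} {c} c∈
    with ∈-filter⁻ (λ c → isProperᵇ G c ≟ᵇ true) {xs = choices (n G) L} c∈
  ... | c∈choices , proper = choices⁻ c∈choices , isProperᵇ⁻ c proper

  tabulate∈colorings : ∀ {L c} → IsColoring G L c → tabulateᵥ c ∈ colorings L
  tabulate∈colorings {c = c} col =
    colorings⁺ (tabulateᵥ c) (IsColoring-resp G (λ v → sym (Vecₚ.lookup∘tabulate c v)) col)

  colorings-unique : ∀ {L} → (∀ v → Unique (L v)) → Unique (colorings L)
  colorings-unique u = Uniqueₚ.filter⁺ (λ c → isProperᵇ G c ≟ᵇ true) (choices-unique u)

  -- Keeps the later arguments by contradiction constructive.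
  LColorable? : ∀ L → Dec (LColorable G L)
  LColorable? L with colorings L in eq
  ... | c ∷ _ = yes (lookupᵥ c , colorings⁻ (subst (c ∈_) (sym eq) (here refl)))
  ... | []    = no λ (_ , col) → case subst (_ ∈_) eq (tabulate∈colorings col) of λ ()

-- Assignments with lists of size at least k

HasLists≥ : (G : Graph) → ℕ → ListAssignment G → Set
HasLists≥ G k L = ∀ v → Unique (L v) × k ≤ length (L v)

exactly⇒≥ : ∀ G {k L} → IsAssignment G k L → HasLists≥ G k L
exactly⇒≥ G A v = proj₁ (A v) , ≤-reflexive (sym (proj₂ (A v)))

take-assignment : ∀ G {k L} → HasLists≥ G k L → IsAssignment G k (take k ∘ L)
take-assignment G {k} A v = Uniqueₚ.take⁺ k (proj₁ (A v)) , length-take-≤ k (proj₂ (A v))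

LColorable-⊆ : ∀ G {L L′} → (∀ v → L v ⊆ L′ v) → LColorable G L → LColorable G L′
LColorable-⊆ G L⊆ (c , c∈ , proper) = c , (λ v → L⊆ v (c∈ v)) , proper

choosable-≥ : ∀ G {k L} → Choosable G k → HasLists≥ G k L → LColorable G L
choosable-≥ G {k} ch A = LColorable-⊆ G (λ _ → take-⊆ k) (ch _ (take-assignment G A))

choosable-mono : ∀ G {j k} → j ≤ k → Choosable G j → Choosable G k
choosable-mono G j≤k ch L A =
  choosable-≥ G ch λ v → proj₁ (A v) , ≤-trans j≤k (≤-reflexive (sym (proj₂ (A v))))

choosable⇒colorable : ∀ G {j} → Choosable G j → Colorable G j
choosable⇒colorable G {j} ch with ch (const (upTo j)) (λ _ → Uniqueₚ.upTo⁺ j , length-upTo j)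
... | c , c∈ , proper = (λ v → fromℕ< (∈-upTo⁻ (c∈ v))) , λ u v uv eq →
  proper u v uv (trans (sym (Finₚ.toℕ-fromℕ< _)) (trans eq (Finₚ.toℕ-fromℕ< _)))

choiceNumber-unique : ∀ G {k l} → IsChoiceNumber G k → IsChoiceNumber G l → k ≡ l
choiceNumber-unique G (chₖ , minₖ) (chₗ , minₗ) = ≤-antisym (minₖ _ chₗ) (minₗ _ chₖ)

-- The product with a complete bipartite graph

-- What remains on a b-side copy with lists `N` once `f i` colors the `i`-th a-side copy.
avoid : ∀ {m a} → (Fin m → List ℕ) → (Fin a → Fin m → ℕ) → Fin m → List ℕ
avoid N f u = N u ∖ tabulate (λ i → f i u)

module Product (M : Graph) (a b : ℕ) where

  V W : Set
  V = Fin (n M)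
  W = Fin a ⊎ Fin b

  at : V → W → Fin (n (M □ K a b))
  at u w = combine u (join a b w)

  coords : Fin (n (M □ K a b)) → V × W
  coords x = proj₁ (remQuot (a + b) x) , splitAt a (proj₂ (remQuot {n M} (a + b) x))

  coords-at : ∀ u w → coords (at u w) ≡ (u , w)
  coords-at u w = trans
    (cong (λ (v , x) → v , splitAt a x) (Finₚ.remQuot-combine u (join a b w)))
    (cong (u ,_) (Finₚ.splitAt-join a b w))

  at-coords : ∀ x → at (proj₁ (coords x)) (proj₂ (coords x)) ≡ x
  at-coords x = trans
    (cong (combine (proj₁ (coords x))) (Finₚ.join-splitAt a b (proj₂ (remQuot {n M} (a + b) x))))
    (Finₚ.combine-remQuot {n M} (a + b) x)

  isLeft : ∀ {a b} → Fin a ⊎ Fin b → Bool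
  isLeft (inj₁ _) = true
  isLeft (inj₂ _) = false

  isLeft-splitAt : ∀ a {b} (w : Fin (a + b)) → (toℕ w <ᵇ a) ≡ isLeft (splitAt a w)
  isLeft-splitAt zero    w       = refl
  isLeft-splitAt (suc a) zero    = refl
  isLeft-splitAt (suc a) (suc w) with splitAt a w | isLeft-splitAt a w
  ... | inj₁ _ | eq = eq
  ... | inj₂ _ | eq = eq

  adj-at : ∀ u w v x → adj (M □ K a b) (at u w) (at v x) ≡
    □-adjPair M (K a b) (u , join a b w) (v , join a b x)
  adj-at u w v x = cong₂ (□-adjPair M (K a b)) (Finₚ.remQuot-combine u _) (Finₚ.remQuot-combine v _)

  adj-copy : ∀ {u v} w → adj M u v ≡ true → adj (M □ K a b) (at u w) (at v w) ≡ true
  adj-copy {u} {v} w uv rewrite adj-at u w v w | eqF-refl (join a b w) | uv = Boolₚ.∨-zeroʳ _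

  adj-cross : ∀ u i j → adj (M □ K a b) (at u (inj₁ i)) (at u (inj₂ j)) ≡ true
  adj-cross u i j
    rewrite adj-at u (inj₁ i) u (inj₂ j) | eqF-refl u
          | isLeft-splitAt a (join a b (inj₁ i)) | isLeft-splitAt a (join a b (inj₂ j))
          | Finₚ.splitAt-join a b (inj₁ i) | Finₚ.splitAt-join a b (inj₂ j) = refl

  onCoords : ∀ {A : Set} → (V → W → A) → Fin (n (M □ K a b)) → A
  onCoords f x = f (proj₁ (coords x)) (proj₂ (coords x))

  onCoords-at : ∀ {A : Set} (f : V → W → A) u w → onCoords f (at u w) ≡ f u w
  onCoords-at f u w = cong (λ (v , x) → f v x) (coords-at u w)

  onCoords-proper : (c : V → W → ℕ) → (∀ w → Proper M (λ u → c u w)) →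
    (∀ u i j → c u (inj₁ i) ≢ c u (inj₂ j)) → Proper (M □ K a b) (onCoords c)
  onCoords-proper c copies cross x y = pairs (remQuot (a + b) x) (remQuot (a + b) y)
    where
    opposite : ∀ u (s t : W) → isLeft s xor isLeft t ≡ true → c u s ≢ c u t
    opposite u (inj₁ i) (inj₂ j) _ = cross u i j
    opposite u (inj₂ j) (inj₁ i) _ = cross u i j ∘ sym

    pairs : ∀ (p q : V × Fin (a + b)) → □-adjPair M (K a b) p q ≡ true →
      c (proj₁ p) (splitAt a (proj₂ p)) ≢ c (proj₁ q) (splitAt a (proj₂ q))
    pairs (u , w) (u′ , w′) adjacent with u ≟ᶠ u′ | w ≟ᶠ w′
    -- Equal in both coordinates: adjacency would need a loop in `M` or in `K a b`.
    ... | yes refl | yes refl rewrite adj-irrefl M u | xor-self (toℕ w <ᵇ a) = case adjacent of λ ()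
    ... | yes refl | no _ rewrite Boolₚ.∨-identityʳ ((toℕ w <ᵇ a) xor (toℕ w′ <ᵇ a))
                                | isLeft-splitAt a w | isLeft-splitAt a w′ =
      opposite u (splitAt a w) (splitAt a w′) adjacent
    ... | no _ | yes refl = copies (splitAt a w) u u′ adjacent
    ... | no _ | no _     = case adjacent of λ ()

  row : ListAssignment (M □ K a b) → W → ListAssignment M
  row L w u = L (at u w)

  -- No edge joins two b-side copies, so each is colored on its own from what the a-side leaves.
  extend : ∀ {L} (f : Fin a → V → ℕ) →
    (∀ i → IsColoring M (row L (inj₁ i)) (f i)) →
    (∀ j → LColorable M (avoid (row L (inj₂ j)) f)) → LColorable (M □ K a b) L
  extend {L} f f-col g = onCoords c , c∈ , onCoords-proper c copies cross
    where
    c : V → W → ℕ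
    c u (inj₁ i) = f i u
    c u (inj₂ j) = proj₁ (g j) u

    g∈ : ∀ j u → proj₁ (g j) u ∈ row L (inj₂ j) u × proj₁ (g j) u ∉ tabulate (λ i → f i u)
    g∈ j u = ∖⁻ (row L (inj₂ j) u) _ (proj₁ (proj₂ (g j)) u)

    c∈row : ∀ u w → c u w ∈ row L w u
    c∈row u (inj₁ i) = proj₁ (f-col i) u
    c∈row u (inj₂ j) = proj₁ (g∈ j u)

    c∈ : ∀ x → onCoords c x ∈ L x
    c∈ x = subst (λ y → onCoords c x ∈ L y) (at-coords x) (c∈row (proj₁ (coords x)) (proj₂ (coords x)))

    copies : ∀ w → Proper M (λ u → c u w)
    copies (inj₁ i) = proj₂ (f-col i)
    copies (inj₂ j) = proj₂ (proj₂ (g j))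

    cross : ∀ u i j → f i u ≢ proj₁ (g j) u
    cross u i j eq = proj₂ (g∈ j u) (subst (_∈ tabulate (λ i → f i u)) eq (∈-tabulate⁺ i))

-- Sizes of the lists left on the b-side

avoid-≥ : ∀ M {a k N} (f : Fin a → Fin (n M) → ℕ) → HasLists≥ M (k + a) N → HasLists≥ M k (avoid N f)
avoid-≥ M {a} {k} {N} f A u = ∖-unique used (proj₁ (A u)) , ℕₚ.+-cancelʳ-≤ a k _ (begin
  k + a                             ≤⟨ proj₂ (A u) ⟩
  length (N u)                      ≤⟨ length-∖ used used (proj₁ (A u)) (λ _ x∈ → x∈) ⟩
  length (N u ∖ used) + length used ≡⟨ cong (length (N u ∖ used) +_) (length-tabulate _) ⟩
  length (N u ∖ used) + a           ∎)
  where
  open ℕₚ.≤-Reasoning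
  used = tabulate λ i → f i u

-- Entry `i` uses a color outside `N u` or repeats that of another entry, so the other `a` entries
-- already account for every loss and one more color survives.
avoid-redundant : ∀ {m a k} (N : Fin m → List ℕ) (f : Fin (suc a) → Fin m → ℕ) u i →
  Unique (N u) → k + suc a ≤ length (N u) →
  (f i u ∈ N u → ∃ λ r → i ≢ r × f r u ≡ f i u) → k < length (avoid N f u)
avoid-redundant {a = a} {k} N f u i uniq k+a≤ redundant = ℕₚ.+-cancelʳ-≤ a (suc k) _ (begin
  suc k + a                           ≡⟨ ℕₚ.+-suc k a ⟨
  k + suc a                           ≤⟨ k+a≤ ⟩
  length (N u)                        ≤⟨ length-∖ used used′ uniq covered ⟩
  length (N u ∖ used) + length used′  ≡⟨ cong (length (N u ∖ used) +_) (length-tabulate _) ⟩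
  length (N u ∖ used) + a             ∎)
  where
  open ℕₚ.≤-Reasoning
  used used′ : List ℕ
  used  = tabulate λ r → f r u
  used′ = tabulate λ r → f (punchIn i r) u

  other : ∀ {r} → i ≢ r → f r u ∈ used′
  other i≢r = subst (λ r → f r u ∈ used′) (Finₚ.punchIn-punchOut i≢r)
    (∈-tabulate⁺ {f = λ r → f (punchIn i r) u} (punchOut i≢r))

  covered : ∀ {x} → x ∈ N u → x ∈ used → x ∈ used′
  covered x∈ x∈used with ∈-tabulate⁻ {f = λ r → f r u} x∈used
  ... | r , refl with i ≟ᶠ r
  ...   | no i≢r = other i≢r
  ...   | yes refl with redundant x∈
  ...     | r′ , i≢r′ , eq = subst (_∈ used′) eq (other i≢r′)

choosable-□K : ∀ M {k} a b → Choosable M k → Choosable (M □ K a b) (k + a)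
choosable-□K M {k} a b ch L A = extend f (λ i → proj₂ (copy i)) λ j →
  choosable-≥ M ch (avoid-≥ M f (rows (inj₂ j)))
  where
  open Product M a b
  rows : ∀ w → HasLists≥ M (k + a) (row L w)
  rows w u = exactly⇒≥ (M □ K a b) A (at u w)

  copy : ∀ i → LColorable M (row L (inj₁ i))
  copy i = choosable-≥ M ch λ u → proj₁ (rows (inj₁ i) u) , ≤-trans (ℕₚ.m≤m+n k a) (proj₂ (rows (inj₁ i) u))

  f : Fin a → V → ℕ
  f i = proj₁ (copy i)

-- The lists that defeat (k + a)-choosability

-- Codes a pair as a number with `i` its remainder modulo `suc a`. Tag `zero` marks the common
-- colors, tag `suc i` those of the `i`-th a-side copy.
tag : ∀ {a} → Fin (suc a) → ℕ → ℕ
tag {a} i x = toℕ i + x * suc a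

tag-injective : ∀ {a} (i j : Fin (suc a)) x y → tag i x ≡ tag j y → i ≡ j × x ≡ y
tag-injective {a} i j x y eq
  with Finₚ.toℕ-injective {i = i} {j} (trans (sym (tag-% i x)) (trans (cong (_% suc a) eq) (tag-% j y)))
  where
  tag-% : ∀ i x → tag i x % suc a ≡ toℕ i
  tag-% i x = trans ([m+kn]%n≡m%n (toℕ i) x (suc a)) (m≤n⇒m%n≡m (Finₚ.toℕ≤pred[n] i))
... | refl = refl , ℕₚ.*-cancelʳ-≡ x y (suc a) (ℕₚ.+-cancelˡ-≡ (toℕ i) _ _ eq)

-- The a copies of M get disjoint copies of L, so they have numColorings M L ^ a joint
-- colorings; each of these leaves only k colors, the same everywhere, on one of the other copies.
¬choosable-□K : ∀ M {k L} a → ¬ Colorable M k → IsAssignment M (k + a) L →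
  ¬ Choosable (M □ K a (numColorings M L ^ a)) (k + a)
¬choosable-□K M {k} {L} a ¬col A ch = ¬col ((λ u → fromℕ< (proj₁ (proj₂ (forced u)))) , forced-proper)
  where
  p = numColorings M L
  open Product M a (p ^ a)

  coloring : Fin p → V → ℕ
  coloring i = lookupᵥ (lookupₗ (colorings M L) i)

  common : List ℕ
  common = map (tag {a} zero) (upTo k)

  -- `finToFun` reads `j` as a choice of one coloring for each a-side copy. Its colors enter the
  -- lists of the `j`-th b-side copy, where that choice blocks them.
  privateColor : Fin (p ^ a) → V → Fin a → ℕ
  privateColor j u i = tag (suc i) (coloring (finToFun {p} {a} j i) u)

  privateColor-tag : ∀ {i x} j u i′ → tag i x ≡ privateColor j u i′ → i ≡ suc i′
  privateColor-tag {i} {x} j u i′ eq = proj₁ (tag-injective i (suc i′) x (coloring (finToFun {p} {a} j i′) u) eq)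

  lists : V → W → List ℕ
  lists u (inj₁ i) = map (tag (suc i)) (L u)
  lists u (inj₂ j) = common ++ tabulate (privateColor j u)

  lists-size : ∀ u w → Unique (lists u w) × length (lists u w) ≡ k + a
  lists-size u (inj₁ i) =
    Uniqueₚ.map⁺ (λ {x} {y} eq → proj₂ (tag-injective (suc i) (suc i) x y eq)) (proj₁ (A u)) ,
    trans (length-map (tag (suc i)) (L u)) (proj₂ (A u))
  lists-size u (inj₂ j) =
    Uniqueₚ.++⁺
      (Uniqueₚ.map⁺ (λ {x} {y} eq → proj₂ (tag-injective {a} zero zero x y eq)) (Uniqueₚ.upTo⁺ k))
      (Uniqueₚ.tabulate⁺ {f = privateColor j u} λ {i} {i′} eq →
        Finₚ.suc-injective (privateColor-tag {x = coloring (finToFun {p} {a} j i) u} j u i′ eq))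
      disjoint ,
    trans (length-++ common)
      (cong₂ _+_ (trans (length-map _ (upTo k)) (length-upTo k)) (length-tabulate (privateColor j u)))
    where
    disjoint : ∀ {x} → ¬ (x ∈ common × x ∈ tabulate (privateColor j u))
    disjoint (x∈ , x∈′) with ∈-map⁻ _ x∈ | ∈-tabulate⁻ {f = privateColor j u} x∈′
    ... | s , _ , refl | i , eq = case privateColor-tag {zero} {s} j u i eq of λ ()

  notPrivate : ∀ u {j y} → y ∈ lists u (inj₂ j) →
    (∀ i → y ≢ privateColor j u i) → ∃ λ s → s < k × y ≡ tag {a} zero s
  notPrivate u {j} y∈ y≢ with ∈-++⁻ common y∈
  ... | inj₁ y∈common with ∈-map⁻ _ y∈common
  ...   | s , s∈ , eq = s , ∈-upTo⁻ s∈ , eq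
  notPrivate u {j} y∈ y≢ | inj₂ y∈private
    with ∈-tabulate⁻ {f = privateColor j u} y∈private
  ... | i , eq = contradiction eq (y≢ i)

  solution : LColorable (M □ K a (p ^ a)) (onCoords lists)
  solution = ch (onCoords lists) λ x → lists-size (proj₁ (coords x)) (proj₂ (coords x))

  c : V → W → ℕ
  c u w = proj₁ solution (at u w)

  c∈ : ∀ u w → c u w ∈ lists u w
  c∈ u w = subst (c u w ∈_) (onCoords-at lists u w) (proj₁ (proj₂ solution) (at u w))

  c-proper : ∀ w → Proper M (λ u → c u w)
  c-proper w u v uv = proj₂ (proj₂ solution) (at u w) (at v w) (adj-copy w uv)

  c-cross : ∀ u i j → c u (inj₁ i) ≢ c u (inj₂ j)
  c-cross u i j = proj₂ (proj₂ solution) (at u (inj₁ i)) (at u (inj₂ j)) (adj-cross u i j)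

  untagged : ∀ i u → ∃ λ x → x ∈ L u × c u (inj₁ i) ≡ tag (suc i) x
  untagged i u = ∈-map⁻ (tag (suc i)) (c∈ u (inj₁ i))

  d : Fin a → V → ℕ
  d i u = proj₁ (untagged i u)

  d-coloring : ∀ i → IsColoring M L (d i)
  d-coloring i = (λ u → proj₁ (proj₂ (untagged i u))) , λ u v uv eq → c-proper (inj₁ i) u v uv
    (trans (proj₂ (proj₂ (untagged i u))) (trans (cong (tag (suc i)) eq) (sym (proj₂ (proj₂ (untagged i v))))))

  position : Fin a → Fin p
  position i = Any.index (tabulate∈colorings M (d-coloring i))

  -- The b-side copy built from exactly the joint coloring that `c` induces on the a-side.
  j : Fin (p ^ a)
  j = funToFin position

  coloring-j : ∀ i u → coloring (finToFun {p} {a} j i) u ≡ d i u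
  coloring-j i u = begin
    coloring (finToFun {p} {a} j i) u      ≡⟨ cong (λ r → coloring r u) (Finₚ.finToFun-funToFin position i) ⟩
    coloring (position i) u        ≡⟨ cong (λ v → lookupᵥ v u) (Anyₚ.lookup-index (tabulate∈colorings M (d-coloring i))) ⟨
    lookupᵥ (tabulateᵥ (d i)) u    ≡⟨ Vecₚ.lookup∘tabulate (d i) u ⟩
    d i u                          ∎
    where
    open ≡-Reasoning

  -- Every private color at `u` sits on an a-side neighbor, so only the `k` common colors remain and
  -- the copy yields a `k`-coloring of `M`.
  forced : ∀ u → ∃ λ s → s < k × c u (inj₂ j) ≡ tag {a} zero s
  forced u = notPrivate u {j} (c∈ u (inj₂ j)) λ i eq → c-cross u i j
    (trans (proj₂ (proj₂ (untagged i u))) (sym (trans eq (cong (tag (suc i)) (coloring-j i u)))))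

  forced-proper : Proper M (λ u → toℕ (fromℕ< (proj₁ (proj₂ (forced u)))))
  forced-proper u v uv eq = c-proper (inj₂ j) u v uv
    (trans (proj₂ (proj₂ (forced u)))
      (trans (cong (tag zero) (trans (sym (Finₚ.toℕ-fromℕ< _)) (trans eq (Finₚ.toℕ-fromℕ< _))))
        (sym (proj₂ (proj₂ (forced v))))))

-- Strongly chromatic-choosable graphs

-- The chromatic number is written `2 + k` here, so `suc k` is the list size in the definition of
-- strength.
module Strong (M : Graph) (k : ℕ) (v₀ : Fin (n M))
  (χ-min : ∀ j → Colorable M j → 2 + k ≤ j)
  (strong : ∀ L → IsAssignment M (suc k) L → ¬ LColorable M L → Constant M L) where

  V : Set
  V = Fin (n M)

  -- A graph with a single vertex is 1-colorable, against `χ-min`.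
  otherVertex : (u : V) → ∃ λ v → u ≢ v
  otherVertex u with any? (λ v → ¬? (u ≟ᶠ v))
  ... | yes found = found
  ... | no none = contradiction
    (χ-min 1 ((λ _ → zero) , λ v w vw → contradiction vw (edgeless v w)))
    (<⇒≱ (s≤s (s≤s z≤n)))
    where
    all≡u : ∀ v → u ≡ v
    all≡u v with u ≟ᶠ v
    ... | yes u≡v = u≡v
    ... | no u≢v  = contradiction (v , u≢v) none

    edgeless : ∀ v w → adj M v w ≢ true
    edgeless v w vw with trans (sym (all≡u v)) (all≡u w)
    ... | refl = case trans (sym vw) (adj-irrefl M v) of λ ()

  -- Every x ∈ L u lies in some sublist of L u of size suc k, and strength applies to that sublist
  -- together with the first suc k colors of every other list.
  nonColorable-⊆ : ∀ {L} → HasLists≥ M (suc k) L → ¬ LColorable M L →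
    ∀ {u v} → u ≢ v → L u ⊆ take (suc k) (L v)
  nonColorable-⊆ {L} A ¬col {u} {v} u≢v {x} x∈ = subst (λ zs → x ∈ take (suc k) zs)
    (Fₚ.updateAt-minimal v u L (u≢v ∘ sym))
    (proj₁ (strong (take (suc k) ∘ L′) (take-assignment M L′-≥)
      (¬col ∘ LColorable-⊆ M λ w → L′-⊆ w ∘ take-⊆ (suc k)) u v x)
      (subst (λ zs → x ∈ take (suc k) zs) (sym (Fₚ.updateAt-updates u L)) (here refl)))
    where
    L′ : ListAssignment M
    L′ = F.updateAt L u (moveToFront x)

    L′-⊆ : ∀ w → L′ w ⊆ L w
    L′-⊆ = updateAt-all (λ w zs → zs ⊆ L w) L u (moveToFront-⊆ x∈) (λ _ _ y∈ → y∈)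

    L′-≥ : HasLists≥ M (suc k) L′
    L′-≥ = updateAt-all (λ _ zs → Unique zs × suc k ≤ length zs) L u
      (moveToFront-unique x (proj₁ (A u)) , ≤-trans (proj₂ (A u)) (length-moveToFront x (proj₁ (A u))))
      (λ w _ → A w)

  nonColorable-constant : ∀ {L} → HasLists≥ M (suc k) L → ¬ LColorable M L → ∀ u v → L u ⊆ L v
  nonColorable-constant A ¬col u v with u ≟ᶠ v
  ... | yes refl = λ x∈ → x∈
  ... | no u≢v   = take-⊆ (suc k) ∘ nonColorable-⊆ A ¬col u≢v

  -- Otherwise `L u` would fit into `suc k` colors of another list, and its length forbids that.
  oneLonger⇒colorable : ∀ {L} → HasLists≥ M (suc k) L → ∀ u → suc k < length (L u) → LColorable M L
  oneLonger⇒colorable {L} A u long with LColorable? M L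
  ... | yes col = col
  ... | no ¬col with otherVertex u
  ...   | v , u≢v = contradiction
    (≤-trans (length-mono-⊆ (proj₁ (A u)) (nonColorable-⊆ A ¬col u≢v))
      (≤-trans (≤-reflexive (length-take (suc k) (L v))) (ℕₚ.m⊓n≤m (suc k) _)))
    (<⇒≱ long)

  colorable-≥ : ∀ {L} → HasLists≥ M (2 + k) L → LColorable M L
  colorable-≥ A = oneLonger⇒colorable (λ v → proj₁ (A v) , ℕₚ.<⇒≤ (proj₂ (A v))) v₀ (proj₂ (A v₀))

  choosable : Choosable M (2 + k)
  choosable L A = colorable-≥ (exactly⇒≥ M A)

  -- Deleting `x` from every list except `L u` leaves `suc k` colors elsewhere and a longer list at
  -- `u`. In a coloring from these lists no other vertex has color `x`, so `u` can be recolored with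
  -- it.
  prescribe : ∀ {L} → HasLists≥ M (2 + k) L → ∀ u {x} → x ∈ L u →
    ∃ λ c → IsColoring M L c × c u ≡ x
  prescribe {L} A u {x} x∈ = c , (c∈ , proper) , Fₚ.updateAt-updates u c′
    where
    removed L′ : ListAssignment M
    removed v = L v ∖ [ x ]
    L′ = F.updateAt removed u (const (L u))

    L′-≥ : HasLists≥ M (suc k) L′
    L′-≥ = updateAt-all (λ _ zs → Unique zs × suc k ≤ length zs) removed u
      (proj₁ (A u) , ℕₚ.<⇒≤ (proj₂ (A u)))
      (λ v _ → ∖-unique [ x ] (proj₁ (A v)) ,
        s≤s⁻¹ (≤-trans (proj₂ (A v)) (length-moveToFront x (proj₁ (A v)))))

    L′-colorable : LColorable M L′
    L′-colorable = oneLonger⇒colorable L′-≥ u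
      (subst (λ zs → suc k < length zs) (sym (Fₚ.updateAt-updates u removed)) (proj₂ (A u)))

    c′ c : V → ℕ
    c′ = proj₁ L′-colorable
    c  = F.updateAt c′ u (const x)

    c′∈ : ∀ v → v ≢ u → c′ v ∈ L v × c′ v ∉ [ x ]
    c′∈ v v≢u = ∖⁻ (L v) [ x ]
      (subst (c′ v ∈_) (Fₚ.updateAt-minimal v u removed v≢u) (proj₁ (proj₂ L′-colorable) v))

    c∈ : ∀ v → c v ∈ L v
    c∈ = updateAt-all (λ v y → y ∈ L v) c′ u x∈ (λ v v≢u → proj₁ (c′∈ v v≢u))

    fromU : ∀ v → v ≢ u → x ≢ c′ v
    fromU v v≢u eq = proj₂ (c′∈ v v≢u) (here (sym eq))

    proper : Proper M c
    proper = updateAt-all (λ v y → ∀ w → adj M v w ≡ true → y ≢ c w) c′ u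
      (updateAt-all (λ w z → adj M u w ≡ true → x ≢ z) c′ u
        (λ uu _ → case trans (sym uu) (adj-irrefl M u) of λ ())
        (λ w w≢u _ → fromU w w≢u))
      (λ v v≢u → updateAt-all (λ w z → adj M v w ≡ true → c′ v ≢ z) c′ u
        (λ _ eq → fromU v v≢u (sym eq))
        (λ w _ → proj₂ (proj₂ L′-colorable) v w))

  -- If f i u ≢ g i u, constancy of both leftover assignments puts f i u in N v and
  -- in { f r v : r } for every v, so picking such an r is a proper coloring of M with suc a colors.
  atMostOneBad : ∀ {a} → suc a < 2 + k → ∀ {N : ListAssignment M} {La : Fin (suc a) → ListAssignment M} →
    HasLists≥ M (suc k + suc a) N →
    (∀ u i r x → x ∈ La i u → x ∈ La r u → i ≡ r) →
    ∀ {f g} → (∀ i → IsColoring M (La i) (f i)) → (∀ i → IsColoring M (La i) (g i)) →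
    ¬ LColorable M (avoid N f) → ¬ LColorable M (avoid N g) → ∀ i u → f i u ≡ g i u
  atMostOneBad {a} a< {N} {La} A disjoint {f} {g} f-col g-col ¬f ¬g i u with f i u ℕₚ.≟ g i u
  ... | yes eq = eq
  ... | no f≢g = contradiction (χ-min (suc a) (proj₁ ∘ index , index-proper)) (<⇒≱ a<)
    where
    x : ℕ
    x = f i u

    -- Without `x` in `N u`, `f` would leave an extra color at `u` and so would extend.
    x∈Nu : x ∈ N u
    x∈Nu with x ∈? N u
    ... | yes x∈ = x∈
    ... | no x∉  = contradiction (oneLonger⇒colorable (avoid-≥ M f A) u
      (avoid-redundant N f u i (proj₁ (A u)) (proj₂ (A u)) λ x∈ → contradiction x∈ x∉)) ¬f

    -- By disjointness only `g i` could take the color `x` at `u`, and it does not.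
    x∉g : x ∉ tabulate (λ r → g r u)
    x∉g x∈ with ∈-tabulate⁻ {f = λ r → g r u} x∈
    ... | r , eq with disjoint u i r x (proj₁ (f-col i) u) (subst (_∈ La r u) (sym eq) (proj₁ (g-col r) u))
    ...   | refl = f≢g eq

    x∈N : ∀ v → x ∈ N v
    x∈N v = proj₁ (∖⁻ (N v) _ (nonColorable-constant (avoid-≥ M g A) ¬g u v (∖⁺ x∈Nu x∉g)))

    -- Were `x` still available at `v` after `f`, constancy would make it available at `u`, where
    -- `f i` uses it.
    x∈f : ∀ v → x ∈ tabulate (λ r → f r v)
    x∈f v with x ∈? tabulate (λ r → f r v)
    ... | yes x∈ = x∈
    ... | no x∉  = contradiction (∈-tabulate⁺ {f = λ r → f r u} i)
      (proj₂ (∖⁻ (N u) _ (nonColorable-constant (avoid-≥ M f A) ¬f v u (∖⁺ (x∈N v) x∉))))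

    index : ∀ v → ∃ λ r → x ≡ f r v
    index v = ∈-tabulate⁻ {f = λ r → f r v} (x∈f v)

    -- Vertices with the same index `r` both have color `x` under `f r`, hence are not adjacent.
    index-proper : Proper M (λ v → toℕ (proj₁ (index v)))
    index-proper v w vw eq = proj₂ (f-col (proj₁ (index v))) v w vw
      (trans (sym (proj₂ (index v)))
        (trans (proj₂ (index w)) (cong (λ r → f r w) (sym (Finₚ.toℕ-injective eq)))))

  -- Choosability of the product with few b-side copies

  module _ {a b : ℕ} {L : ListAssignment (M □ K (suc a) b)}
    (A : IsAssignment (M □ K (suc a) b) (suc k + suc a) L) where

    open Product M (suc a) b hiding (V)

    rows : ∀ w → HasLists≥ M (suc k + suc a) (row L w)
    rows w u = exactly⇒≥ (M □ K (suc a) b) A (at u w)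

    -- The shared color x can be used on both copies at u, which leaves an extra color there
    -- on every copy of the other side.
    colorable-shared : ∀ {u i r x} → i ≢ r → x ∈ row L (inj₁ i) u → x ∈ row L (inj₁ r) u →
      LColorable (M □ K (suc a) b) L
    colorable-shared {u} {i} {r} {x} i≢r x∈i x∈r = extend f f-coloring λ j →
      oneLonger⇒colorable (avoid-≥ M f (rows (inj₂ j))) u
        (avoid-redundant (row L (inj₂ j)) f u i (proj₁ (rows (inj₂ j) u)) (proj₂ (rows (inj₂ j) u))
          λ _ → r , i≢r , trans (f-x r x∈r) (sym (f-x i x∈i)))
      where
      rows-≥ : ∀ s → HasLists≥ M (2 + k) (row L (inj₁ s))
      rows-≥ s v = proj₁ (rows (inj₁ s) v) ,
        ≤-trans (subst (2 + k ≤_) (sym (ℕₚ.+-suc (suc k) a)) (ℕₚ.m≤m+n (2 + k) a)) (proj₂ (rows (inj₁ s) v))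

      -- Copies whose list at `u` lacks `x` may take any coloring.
      prefer-x : ∀ s → ∃ λ c → IsColoring M (row L (inj₁ s)) c × (x ∈ row L (inj₁ s) u → c u ≡ x)
      prefer-x s with x ∈? row L (inj₁ s) u
      ... | yes x∈ = let c , col , cu≡x = prescribe (rows-≥ s) u x∈ in c , col , const cu≡x
      ... | no x∉  = let c , col = colorable-≥ (rows-≥ s) in c , col , λ x∈ → contradiction x∈ x∉

      f : Fin (suc a) → V → ℕ
      f s = proj₁ (prefer-x s)

      f-coloring : ∀ s → IsColoring M (row L (inj₁ s)) (f s)
      f-coloring s = proj₁ (proj₂ (prefer-x s))

      f-x : ∀ s → x ∈ row L (inj₁ s) u → f s u ≡ x
      f-x s = proj₂ (proj₂ (prefer-x s))

    -- If no joint coloring extended, each would be spoiled by some b-side copy; since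
    -- `b < p ^ suc a`, two distinct ones would share a spoiler, against `atMostOneBad`.
    colorable-disjoint : ∀ {p} → suc a < 2 + k → (∀ i → p ≤ numColorings M (row L (inj₁ i))) →
      b < p ^ suc a → (∀ u i r x → x ∈ row L (inj₁ i) u → x ∈ row L (inj₁ r) u → i ≡ r) →
      LColorable (M □ K (suc a) b) L
    colorable-disjoint {p} a< p≤ b< disjoint =
      let t , good = goodJoint in extend (joint t) (joint-coloring t) good
      where
      -- Only the first `p` colorings of each a-side copy enter, so `Fin (p ^ suc a)` indexes the
      -- joint colorings.
      position : ∀ i → Fin (p ^ suc a) → Fin (numColorings M (row L (inj₁ i)))
      position i t = inject≤ (finToFun t i) (p≤ i)

      joint : Fin (p ^ suc a) → Fin (suc a) → V → ℕ
      joint t i = lookupᵥ (lookupₗ (colorings M (row L (inj₁ i))) (position i t))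

      joint-coloring : ∀ t i → IsColoring M (row L (inj₁ i)) (joint t i)
      joint-coloring t i = colorings⁻ M (∈-lookup (position i t))

      joint-injective : ∀ s t → (∀ i u → joint s i u ≡ joint t i u) → s ≡ t
      joint-injective s t eq = finToFun-injective {k = suc a} s t λ i →
        Finₚ.inject≤-injective (p≤ i) (p≤ i) _ _
          (lookup-injective (colorings-unique M λ u → proj₁ (rows (inj₁ i) u)) (position i s) (position i t)
            (trans (sym (Vecₚ.tabulate∘lookup _)) (trans (Vecₚ.tabulate-cong (eq i)) (Vecₚ.tabulate∘lookup _))))

      good? : ∀ t j → Dec (LColorable M (avoid (row L (inj₂ j)) (joint t)))
      good? t j = LColorable? M (avoid (row L (inj₂ j)) (joint t))

      goodJoint : ∃ λ t → ∀ j → LColorable M (avoid (row L (inj₂ j)) (joint t))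
      goodJoint with any? (λ t → all? (good? t))
      ... | yes found = found
      ... | no none   = contradiction s≡t (Finₚ.<⇒≢ s<t)
        where
        spoiler : ∀ t → ∃ λ j → ¬ LColorable M (avoid (row L (inj₂ j)) (joint t))
        spoiler t = Finₚ.¬∀⟶∃¬ b _ (good? t) λ good → none (t , good)

        collision = Finₚ.pigeonhole b< (proj₁ ∘ spoiler)
        s   = proj₁ collision
        t   = proj₁ (proj₂ collision)
        s<t = proj₁ (proj₂ (proj₂ collision))

        s≡t : s ≡ t
        s≡t = joint-injective s t (atMostOneBad a< {La = λ i → row L (inj₁ i)}
          (rows (inj₂ (proj₁ (spoiler s)))) disjoint
          (joint-coloring s) (joint-coloring t) (proj₂ (spoiler s))
          (subst (λ j → ¬ LColorable M (avoid (row L (inj₂ j)) (joint t)))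
            (sym (proj₂ (proj₂ (proj₂ collision)))) (proj₂ (spoiler t))))

  choosable-few : ∀ {a b p} → suc a < 2 + k →
    (∀ L → IsAssignment M (suc k + suc a) L → p ≤ numColorings M L) →
    b < p ^ suc a → Choosable (M □ K (suc a) b) (suc k + suc a)
  choosable-few {a} {b} a< p≤ b< L A
    with any? (λ u → any? λ i → any? λ r →
      ¬? (i ≟ᶠ r) ×-dec Any.any? (_∈? row L (inj₁ r) u) (row L (inj₁ i) u))
    where
    open Product M (suc a) b
  ... | yes (u , i , r , i≢r , shared) = let x , x∈i , x∈r = find shared in colorable-shared A i≢r x∈i x∈r
  ... | no noneShared = colorable-disjoint A a< (λ i → p≤ _ λ u → A (Product.at M (suc a) b u (inj₁ i))) b< disjoint
    where
    open Product M (suc a) b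
    disjoint : ∀ u i r x → x ∈ row L (inj₁ i) u → x ∈ row L (inj₁ r) u → i ≡ r
    disjoint u i r x x∈i x∈r with i ≟ᶠ r
    ... | yes i≡r = i≡r
    ... | no i≢r  = contradiction (u , i , r , i≢r , lose x∈i x∈r) noneShared

  -- The choice number of M and the value of f_a

  choiceNumber : IsChoiceNumber M (2 + k)
  choiceNumber = choosable , λ j ch → χ-min j (choosable⇒colorable M ch)

  isFa : ∀ {a p} → suc a < 2 + k → IsListColorFunction M (suc k + suc a) p → IsFa (suc a) M (p ^ suc a)
  isFa {a} {p} a< ((L , A , L-count) , p-min) =
    ℕₚ.m^n>0 p {{>-nonZero p>0}} (suc a) ,
    (2 + k , choiceNumber , choosable-□K M (suc a) (p ^ suc a) choosable , minimal) ,
    least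
    where
    -- The minimum is attained by `L`, and lists of at least `2 + k` colors admit a coloring.
    p>0 : 0 < p
    p>0 = subst (0 <_) L-count (≤-trans (s≤s z≤n) (Finₚ.toℕ<n (Any.index
      (tabulate∈colorings M (proj₂ (choosable-mono M 2+k≤ choosable L A))))))
      where
      2+k≤ : 2 + k ≤ suc k + suc a
      2+k≤ = subst (2 + k ≤_) (sym (ℕₚ.+-suc (suc k) a)) (ℕₚ.m≤m+n (2 + k) a)

    -- Choosability passes to larger lists, so a smaller `j` would give it for size `suc k + suc a`,
    -- one short; the lists built from the minimizing `L` refute this.
    minimal : ∀ j → Choosable (M □ K (suc a) (p ^ suc a)) j → 2 + k + suc a ≤ j
    minimal j ch with 2 + k + suc a ≤? j
    ... | yes ≤j = ≤j
    ... | no ≰j  = contradiction (choosable-mono (M □ K (suc a) (p ^ suc a)) (s≤s⁻¹ (≰⇒> ≰j)) ch)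
      (subst (λ q → ¬ Choosable (M □ K (suc a) (q ^ suc a)) (suc k + suc a)) L-count
        (¬choosable-□K M (suc a) (λ col → ℕₚ.<-irrefl refl (χ-min (suc k) col)) A))

    -- For `b` below `p ^ suc a`, lists of size `suc k + suc a` already suffice, one less than the
    -- required choice number.
    least : ∀ b → 1 ≤ b → FaProp (suc a) M b → p ^ suc a ≤ b
    least b _ (l , l-choice , _ , l+a-min) with choiceNumber-unique M l-choice choiceNumber
    ... | refl with p ^ suc a ≤? b
    ...   | yes ≤b = ≤b
    ...   | no ≰b  = contradiction (l+a-min (suc k + suc a) (choosable-few a< p-min (≰⇒> ≰b))) (ℕₚ.<-irrefl refl)

-- The bound `suc a < χ` gives `χ` the form `2 + k`, and `l` equals it, so `l + suc a ∸ 1` computes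
-- to `suc k + suc a`.
isFa-strong : ∀ {a M χ l p} → Fin (n M) → suc a < χ → StrongChromaticChoosable M χ →
  IsChoiceNumber M l → IsListColorFunction M (l + suc a ∸ 1) p → IsFa (suc a) M (p ^ suc a)
isFa-strong {M = M} {suc (suc k)} v₀ a<χ@(s≤s (s≤s _)) ((_ , χ-min) , strong) l-choice isP
  with choiceNumber-unique M l-choice (Strong.choiceNumber M k v₀ χ-min strong)
... | refl = Strong.isFa M k v₀ χ-min strong a<χ isP

theorem1p8 : (a : ℕ) → 1 ≤ a → (M : Graph) → 1 ≤ n M →
    StronglyChromaticChoosable M →
    (χ : ℕ) → IsChromaticNumber M χ → a + 1 ≤ χ →
    (l : ℕ) → IsChoiceNumber M l →
    (p : ℕ) → IsListColorFunction M (l + a ∸ 1) p →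
    IsFa a M (p ^ a)
theorem1p8 (suc a) _ M 1≤n (k , (M-col , k-min) , strong) χ (M-col′ , χ-min) a<χ l l-choice p isP =
  isFa-strong {M = M} (fromℕ< 1≤n) (subst₂ _≤_ (ℕₚ.+-comm (suc a) 1) χ≡k a<χ)
    ((M-col , k-min) , strong) l-choice isP
  where
  -- The chromatic number inside the strength hypothesis agrees with the given one, by minimality of
  -- both.
  χ≡k : χ ≡ k
  χ≡k = ≤-antisym (χ-min k M-col) (k-min χ M-col′)
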